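{- Let $n\ge1$ and let $\lambda$ be an integer partition of $n-1$. For every $r\in[n]$ there is a bijection $\Phi_r:\mathcal{T}_{n,\lambda}\to\mathcal{T}^{(r)}_{n,\lambda}$.
   Context: $\mathcal{T}_n$ is the set of unrooted labeled trees on the vertex set $[n]=\{1,\dots,n\}$. Local orientation: each edge $\{i,j\}$ with $i<j$ of such a tree is oriented $i\to j$. The local indegree of a vertex $v$ is the number of edges oriented towards $v$, i.e. the number of neighbours of $v$ that are smaller than $v$. Global orientation: a tree rooted at $r$ has every edge oriented towards the root. The global indegree of a vertex is the number of edges oriented towards it, i.e. its number of children. The (local, respectively global) indegree sequence of a tree is the integer partition $1^{e_1}2^{e_2}\cdots$, where $e_i$ is the number of vertices of (local, respectively global) indegree $i$ for $i\ge1$. It is a partition of $n-1$. $\mathcal{T}_{n,\lambda}$ is the set of trees in $\mathcal{T}_n$ whose local indegree sequence is $\lambda$. $\mathcal{T}^{(r)}_{n,\lambda}$ is the set of labeled trees on $[n]$ rooted at $r$ whose global indegree sequence is $\lambda$. -}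

module Defs where

open import Level using (0ℓ)
open import Data.Nat using (ℕ; zero; suc; _≤_; _<_; _∸_; _≟_; _<?_)
open import Data.Bool using (Bool; true; false; T)
open import Data.Fin using (Fin; toℕ)
open import Data.Fin.Properties using () renaming (_≟_ to _≟ᶠ_)
open import Data.List using (List; []; _∷_; _++_; [_]; length; filter; allFin)
open import Data.Nat.ListAction using (sum)
open import Data.List.Relation.Unary.All using (All)
open import Data.List.Relation.Unary.Linked using (Linked)
open import Data.List.Relation.Unary.Unique.Propositional using (Unique)
open import Data.Product using (Σ; _×_; proj₁)
open import Relation.Nullary using (¬_; yes; no)
open import Relation.Nullary.Decidable using (_×-dec_)
open import Relation.Binary using (Setoid)
open import Relation.Binary.PropositionalEquality using (_≡_; refl; sym; trans)
open import Data.Bool.Properties using () renaming (_≟_ to _≟ᵇ_)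

-- Vertex set [n] is represented by Fin n, vertex i ∈ Fin n standing for the
-- label toℕ i + 1 (this preserves the order of labels).

Graph : ℕ → Set
Graph n = Fin n → Fin n → Bool

Adj : ∀ {n} → Graph n → Fin n → Fin n → Set
Adj G u v = T (G u v)

data Walk {n} (G : Graph n) : Fin n → Fin n → Set where
  here : ∀ {u} → Walk G u u
  step : ∀ {u v w} → Adj G u v → Walk G v w → Walk G u w

Connected : ∀ {n} → Graph n → Set
Connected G = ∀ u v → Walk G u v

HasCycle : ∀ {n} → Graph n → Set
HasCycle {n} G = Σ (Fin n) λ x → Σ (List (Fin n)) λ xs →
  (2 ≤ length xs) × Unique (x ∷ xs) × Linked (Adj G) (x ∷ xs ++ [ x ])

IsTree : ∀ {n} → Graph n → Set
IsTree G = (∀ u v → G u v ≡ G v u) × (∀ u → G u u ≡ false)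
         × Connected G × ¬ HasCycle G

mult : ∀ {n} → (Fin n → ℕ) → ℕ → ℕ
mult {n} f i = length (filter (λ v → f v ≟ i) (allFin n))

occ : List ℕ → ℕ → ℕ
occ λs i = length (filter (λ k → k ≟ i) λs)

IsPartition : List ℕ → ℕ → Set
IsPartition λs m = Linked (λ a b → b ≤ a) λs × All (λ k → 1 ≤ k) λs × sum λs ≡ m

-- The indegree sequence 1^{e1} 2^{e2} ... of the indegree function d equals λ:
-- for every i ≥ 1, e_i = #{v : d v = i} equals the multiplicity of i in λ.
HasIndegSeq : ∀ {n} → (Fin n → ℕ) → List ℕ → Set
HasIndegSeq d λs = ∀ i → 1 ≤ i → mult d i ≡ occ λs i

localIndeg : ∀ {n} → Graph n → Fin n → ℕ
localIndeg {n} G v =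
  length (filter (λ u → (toℕ u <? toℕ v) ×-dec (G u v ≟ᵇ true)) (allFin n))

degree : ∀ {n} → Graph n → Fin n → ℕ
degree {n} G v = length (filter (λ u → G u v ≟ᵇ true) (allFin n))

-- Global indegree in the tree rooted at r (edges oriented towards r) = number
-- of children of v = number of neighbours of v other than its parent, i.e.
-- degree v for v = r and degree v - 1 otherwise.
globalIndeg : ∀ {n} → Fin n → Graph n → Fin n → ℕ
globalIndeg r G v with v ≟ᶠ r
... | yes _ = degree G v
... | no  _ = degree G v ∸ 1

LocalTrees : (n : ℕ) → List ℕ → Setoid 0ℓ 0ℓ
LocalTrees n λs = record
  { Carrier = Σ (Graph n) λ G → IsTree G × HasIndegSeq (localIndeg G) λs
  ; _≈_ = λ A B → ∀ u v → proj₁ A u v ≡ proj₁ B u v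
  ; isEquivalence = record
    { refl = λ u v → refl
    ; sym = λ p u v → sym (p u v)
    ; trans = λ p q u v → trans (p u v) (q u v) } }

RootedTrees : (n : ℕ) → Fin n → List ℕ → Setoid 0ℓ 0ℓ
RootedTrees n r λs = record
  { Carrier = Σ (Graph n) λ G → IsTree G × HasIndegSeq (globalIndeg r G) λs
  ; _≈_ = λ A B → ∀ u v → proj₁ A u v ≡ proj₁ B u v
  ; isEquivalence = record
    { refl = λ u v → refl
    ; sym = λ p u v → sym (p u v)
    ; trans = λ p q u v → trans (p u v) (q u v) } }

{-# OPTIONS --safe #-}
module Submission where

-- Number the vertices 0, …, N and root every tree at 0, so that a tree becomes a parent map f.
-- Each edge u → f u points locally to max u (f u) and globally to f u, so both indegree
-- sequences are the multiset of fibre sizes of a map on the non-root vertices, namely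
-- u ↦ max u (f u) and u ↦ f u.
--
-- Parent maps correspond to codes, that is arbitrary maps f with f 0 = f N = 0: a cycle
-- with maximum v is merged into the path from N to 0 by exchanging the values at N and v.
-- Taking the cycles in increasing order of v leaves the local heads max u (f u) unchanged,
-- and obviously permutes the values f u.
--
-- On codes the two statistics are exchanged by a greedy relabelling: for v = 1, …, N apply
-- the transposition (v, min v (f v)) to the values at the smaller vertices. The resulting
-- code is σ (max u (f u)) for a permutation σ, so it has the same fibre sizes.

open import Defs
open import Data.Nat using (ℕ; _≤_; _∸_)
open import Data.Fin using (Fin)
open import Data.List using (List)
open import Function.Bundles using (Bijection)

open import Data.Bool.Base using (true; false; T)
open import Data.Bool.Properties using (T-≡) renaming (_≟_ to _≟ᵇ_)
open import Data.Empty using (⊥; ⊥-elim)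
open import Data.Fin.Base using (zero; suc; toℕ; fromℕ; fromℕ<)
import Data.Fin.Base as Fin
open import Data.Fin.Permutation using (Permutation′; _⟨$⟩ʳ_; _∘ₚ_; transpose)
import Data.Fin.Permutation as Perm
open import Data.Fin.Properties
  using (_≟_; suc-injective; _≤?_; _<?_; toℕ-injective; toℕ-fromℕ; toℕ-fromℕ<; toℕ≤pred[n])
open import Data.List.Base using ([]; _∷_; _++_; [_]; length; filter; allFin; tabulate)
open import Data.List.Membership.DecPropositional using () renaming (_∈?_ to member?)
open import Data.List.Membership.Propositional using (_∈_)
open import Data.List.Properties using (filter-≐)
open import Data.List.Relation.Unary.All using (All; []; _∷_)
import Data.List.Relation.Unary.All as All
open import Data.List.Relation.Unary.All.Properties using (¬Any⇒All¬)
open import Data.List.Relation.Unary.AllPairs using ([]; _∷_)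
open import Data.List.Relation.Unary.Any using (here; there)
open import Data.List.Relation.Unary.Linked using (Linked; [-]; _∷_)
open import Data.List.Relation.Unary.Unique.Propositional using (Unique)
open import Data.Nat.Base using (zero; suc; _+_; _<_; z≤n; s≤s)
import Data.Nat.Properties as ℕ
open import Algebra.Properties.CommutativeMonoid.Sum ℕ.+-0-commutativeMonoid
  using (sum; sum-cong-≗; ∑-distrib-+; sum-permute)
open import Data.Product.Base using (Σ; ∃; _×_; _,_; proj₁; proj₂)
open import Data.Sum.Base using (_⊎_; inj₁; inj₂; [_,_]′; swap)
open import Function.Base using (_∘_)
open import Function.Bundles using (Inverse; Injection; Equivalence)
import Function.Construct.Composition as Compose
import Function.Construct.Identity as Identity
import Function.Construct.Symmetry as Symmetry
open import Function.Properties.Inverse using (↔⇒↣; Inverse⇒Bijection)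
open import Level using (0ℓ)
open import Relation.Binary.Bundles using (Setoid)
open import Relation.Binary.Construct.Closure.ReflexiveTransitive
  using (Star; ε; _◅_; _◅◅_; reverse)
open import Relation.Binary.Core using (Rel)
open import Relation.Binary.PropositionalEquality hiding ([_])
open import Relation.Nullary using (¬_; Dec; yes; no; ¬?)
open import Relation.Nullary.Decidable using (_×-dec_; _⊎-dec_; ⌊_⌋; toWitness; fromWitness)
open import Relation.Nullary.Negation using (contradiction)
open import Relation.Unary using (Pred; Decidable)

-- Counting

count : ∀ {n} {P : Pred (Fin n) 0ℓ} → Decidable P → ℕ
count {n} P? = length (filter P? (allFin n))

count-cong : ∀ {n} {P Q : Pred (Fin n) 0ℓ} (P? : Decidable P) (Q? : Decidable Q) →
  (∀ {u} → P u → Q u) → (∀ {u} → Q u → P u) → count P? ≡ count Q?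
count-cong {n} P? Q? P⊆Q Q⊆P = cong length (filter-≐ P? Q? (P⊆Q , Q⊆P) (allFin n))

indicator : ∀ {P : Set} → Dec P → ℕ
indicator (yes _) = 1
indicator (no  _) = 0

-- Finite sums supply invariance under permutations and additivity.
count-sum : ∀ {n} {P : Pred (Fin n) 0ℓ} (P? : Decidable P) → count P? ≡ sum (indicator ∘ P?)
count-sum P? = go (λ u → u)
  where
  go : ∀ {m} (h : Fin m → Fin _) → length (filter P? (tabulate h)) ≡ sum (indicator ∘ P? ∘ h)
  go {zero}  h = refl
  go {suc m} h with P? (h zero)
  ... | yes _ = cong suc (go (h ∘ suc))
  ... | no  _ = go (h ∘ suc)

count-permute : ∀ {n} {P : Pred (Fin n) 0ℓ} (P? : Decidable P) (π : Permutation′ n) →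
  count (P? ∘ (π ⟨$⟩ʳ_)) ≡ count P?
count-permute P? π = begin
  count (P? ∘ (π ⟨$⟩ʳ_))                ≡⟨ count-sum (P? ∘ (π ⟨$⟩ʳ_)) ⟩
  sum (indicator ∘ P? ∘ (π ⟨$⟩ʳ_))      ≡⟨ sum-permute (indicator ∘ P?) π ⟨
  sum (indicator ∘ P?)                  ≡⟨ count-sum P? ⟨
  count P?                              ∎
  where open ≡-Reasoning

count-⊎ : ∀ {n} {P Q : Pred (Fin n) 0ℓ} (P? : Decidable P) (Q? : Decidable Q) →
  (∀ {u} → P u → ¬ Q u) → count (λ u → P? u ⊎-dec Q? u) ≡ count P? + count Q?
count-⊎ P? Q? disjoint = begin
  count (λ u → P? u ⊎-dec Q? u)                      ≡⟨ count-sum (λ u → P? u ⊎-dec Q? u) ⟩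
  sum (λ u → indicator (P? u ⊎-dec Q? u))            ≡⟨ sum-cong-≗ split ⟩
  sum (λ u → indicator (P? u) + indicator (Q? u))    ≡⟨ ∑-distrib-+ (indicator ∘ P?) (indicator ∘ Q?) ⟩
  sum (indicator ∘ P?) + sum (indicator ∘ Q?)        ≡⟨ cong₂ _+_ (count-sum P?) (count-sum Q?) ⟨
  count P? + count Q?                                ∎
  where
  open ≡-Reasoning
  split : ∀ u → indicator (P? u ⊎-dec Q? u) ≡ indicator (P? u) + indicator (Q? u)
  split u with P? u | Q? u
  ... | yes p | yes q = contradiction q (disjoint p)
  ... | yes _ | no  _ = refl
  ... | no  _ | yes _ = refl
  ... | no  _ | no  _ = refl

count-none : ∀ {n} {P : Pred (Fin n) 0ℓ} (P? : Decidable P) → (∀ u → ¬ P u) → count P? ≡ 0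
count-none {n} P? none = cong length (go (allFin n))
  where
  go : ∀ us → filter P? us ≡ []
  go []       = refl
  go (u ∷ us) with P? u
  ... | yes p = contradiction p (none u)
  ... | no  _ = go us

indicator-cong : ∀ {P Q : Set} (p? : Dec P) (q? : Dec Q) → (P → Q) → (Q → P) → indicator p? ≡ indicator q?
indicator-cong (yes p) (yes q) P⇒Q Q⇒P = refl
indicator-cong (yes p) (no ¬q) P⇒Q Q⇒P = contradiction (P⇒Q p) ¬q
indicator-cong (no ¬p) (yes q) P⇒Q Q⇒P = contradiction (Q⇒P q) ¬p
indicator-cong (no ¬p) (no ¬q) P⇒Q Q⇒P = refl

count-≟ : ∀ {n} (v : Fin n) → count (_≟ v) ≡ 1
count-≟ v = trans (count-sum (_≟ v)) (go v)
  where
  go : ∀ {n} (v : Fin n) → sum (λ u → indicator (u ≟ v)) ≡ 1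
  go {suc n} zero    = cong suc (trans (sym (count-sum {n} zero?)) (count-none zero? (λ _ ())))
    where
    zero? : Decidable (λ (u : Fin n) → suc u ≡ zero)
    zero? u = suc u ≟ zero
  go (suc v) = trans
    (sum-cong-≗ (λ u → indicator-cong (suc u ≟ suc v) (u ≟ v) suc-injective (cong suc)))
    (go v)

mult-cong : ∀ {n} (d e : Fin n → ℕ) → d ≗ e → ∀ i → mult d i ≡ mult e i
mult-cong d e d≗e i = count-cong (λ v → d v ℕ.≟ i) (λ v → e v ℕ.≟ i)
  (λ {u} → trans (sym (d≗e u))) (λ {u} → trans (d≗e u))

mult-permute : ∀ {n} (d : Fin n → ℕ) (π : Permutation′ n) → ∀ i → mult (d ∘ (π ⟨$⟩ʳ_)) i ≡ mult d i
mult-permute d π i = count-permute (λ v → d v ℕ.≟ i) π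

-- The root is left out: a parent map sends it to itself by convention, and this loop is no edge.
child? : ∀ {n} (r : Fin n) (f : Fin n → Fin n) (v : Fin n) → Decidable (λ u → u ≢ r × f u ≡ v)
child? r f v u = ¬? (u ≟ r) ×-dec (f u ≟ v)

children : ∀ {n} → Fin n → (Fin n → Fin n) → Fin n → ℕ
children r f v = count (child? r f v)

children-cong : ∀ {n} (r : Fin n) f g → (∀ u → u ≢ r → f u ≡ g u) → children r f ≗ children r g
children-cong r f g f≡g v = count-cong (child? r f v) (child? r g v)
  (λ (u≢r , fu≡v) → u≢r , trans (sym (f≡g _ u≢r)) fu≡v)
  (λ (u≢r , gu≡v) → u≢r , trans (f≡g _ u≢r) gu≡v)

permutation-injective : ∀ {n} (π : Permutation′ n) {x y} → π ⟨$⟩ʳ x ≡ π ⟨$⟩ʳ y → x ≡ y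
permutation-injective π = Injection.injective (↔⇒↣ π)

children-permuteᵛ : ∀ {n} (r : Fin n) f (σ : Permutation′ n) v →
  children r ((σ ⟨$⟩ʳ_) ∘ f) (σ ⟨$⟩ʳ v) ≡ children r f v
children-permuteᵛ r f σ v = count-cong (child? r ((σ ⟨$⟩ʳ_) ∘ f) (σ ⟨$⟩ʳ v)) (child? r f v)
  (λ (u≢r , eq) → u≢r , permutation-injective σ eq)
  (λ (u≢r , eq) → u≢r , cong (σ ⟨$⟩ʳ_) eq)

children-permuteᵘ : ∀ {n} (r : Fin n) {r′} f (π : Permutation′ n) → π ⟨$⟩ʳ r ≡ r′ →
  children r (f ∘ (π ⟨$⟩ʳ_)) ≗ children r′ f
children-permuteᵘ r {r′} f π πr≡r′ v = trans
  (count-cong (child? r (f ∘ (π ⟨$⟩ʳ_)) v) (child? r′ f v ∘ (π ⟨$⟩ʳ_))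
    (λ (u≢r , eq) → (λ πu≡r′ → u≢r (permutation-injective π (trans πu≡r′ (sym πr≡r′)))) , eq)
    (λ (πu≢r′ , eq) → (λ u≡r → πu≢r′ (trans (cong (π ⟨$⟩ʳ_) u≡r) πr≡r′)) , eq))
  (count-permute (child? r′ f v) π)

-- Transpositions and maps

transposeˡ : ∀ {n} (i j : Fin n) → transpose i j ⟨$⟩ʳ i ≡ j
transposeˡ i j with i ≟ i
... | yes _  = refl
... | no i≢i = contradiction refl i≢i

transposeʳ : ∀ {n} (i j : Fin n) → transpose i j ⟨$⟩ʳ j ≡ i
transposeʳ i j with j ≟ i
... | yes j≡i = j≡i
... | no _ with j ≟ j
...   | yes _  = refl
...   | no j≢j = contradiction refl j≢j

transpose-other : ∀ {n} (i j : Fin n) {k} → k ≢ i → k ≢ j → transpose i j ⟨$⟩ʳ k ≡ k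
transpose-other i j {k} k≢i k≢j with k ≟ i
... | yes k≡i = contradiction k≡i k≢i
... | no _ with k ≟ j
...   | yes k≡j = contradiction k≡j k≢j
...   | no _    = refl

transpose-involutive : ∀ {n} (i j k : Fin n) → transpose i j ⟨$⟩ʳ (transpose i j ⟨$⟩ʳ k) ≡ k
transpose-involutive i j k with k ≟ i
... | yes refl = transposeʳ k j
... | no k≢i with k ≟ j
...   | yes refl = transposeˡ i k
...   | no k≢j   = transpose-other i j k≢i k≢j

Map : ℕ → Set
Map n = Fin n → Fin n

Maps : ∀ {n} → (Map n → Set) → Setoid 0ℓ 0ℓ
Maps P = record
  { Carrier       = Σ _ P
  ; _≈_           = λ f g → proj₁ f ≗ proj₁ g
  ; isEquivalence = record
    { refl  = λ _ → refl
    ; sym   = λ p u → sym (p u)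
    ; trans = λ p q u → trans (p u) (q u) } }

-- One self-inverse formula serves in both directions, while `P` and `Q` may differ, as in the
-- merging stages and the change of root.
involution : ∀ {n} {P Q : Map n → Set} (φ : Map n → Map n) →
  (∀ {f g} → f ≗ g → φ f ≗ φ g) → (∀ f → φ (φ f) ≗ f) →
  (∀ {f} → P f → Q (φ f)) → (∀ {f} → Q f → P (φ f)) → Inverse (Maps P) (Maps Q)
involution φ φ-cong φ-inv P⇒Q Q⇒P = record
  { to        = λ (f , p) → φ f , P⇒Q p
  ; from      = λ (f , q) → φ f , Q⇒P q
  ; to-cong   = φ-cong
  ; from-cong = φ-cong
  ; inverse   = (λ {f} y≗φf u → trans (φ-cong y≗φf u) (φ-inv (proj₁ f) u))
              , (λ {f} y≗φf u → trans (φ-cong y≗φf u) (φ-inv (proj₁ f) u)) }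

module _ {n : ℕ} where

  larger smaller : Fin n → Fin n → Fin n
  larger  v w with w ≤? v
  ... | yes _ = v
  ... | no  _ = w
  smaller v w with w ≤? v
  ... | yes _ = w
  ... | no  _ = v

  larger-≤ : ∀ {v w} → w Fin.≤ v → larger v w ≡ v
  larger-≤ {v} {w} w≤v with w ≤? v
  ... | yes _  = refl
  ... | no w≰v = contradiction w≤v w≰v

  larger-≰ : ∀ {v w} → ¬ w Fin.≤ v → larger v w ≡ w
  larger-≰ {v} {w} w≰v with w ≤? v
  ... | yes w≤v = contradiction w≤v w≰v
  ... | no _    = refl

  ≤-larger : ∀ v w → v Fin.≤ larger v w
  ≤-larger v w with w ≤? v
  ... | yes _  = ℕ.≤-refl
  ... | no w≰v = ℕ.<⇒≤ (ℕ.≰⇒> w≰v)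

  smaller-≤ : ∀ v w → smaller v w Fin.≤ v
  smaller-≤ v w with w ≤? v
  ... | yes w≤v = w≤v
  ... | no _    = ℕ.≤-refl

  <⇒≢ : ∀ {v w : Fin n} → v Fin.< w → v ≢ w
  <⇒≢ v<w v≡w = ℕ.<⇒≢ v<w (cong toℕ v≡w)

  -- If `w` is at most `v`, the transposition exchanges `v` and `w`; otherwise it is trivial and the
  -- maximum is `w` already. This identity makes the relabelling turn local heads into values.
  swap-larger : ∀ v w → transpose v (smaller v w) ⟨$⟩ʳ larger v w ≡ w
  swap-larger v w with w ≤? v
  ... | yes _  = transposeˡ v w
  ... | no w≰v = transpose-other v v w≢v w≢v
    where
    w≢v : w ≢ v
    w≢v w≡v = w≰v (ℕ.≤-reflexive (cong toℕ w≡v))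

heads : ∀ {n} → Map n → Map n
heads f u = larger u (f u)

-- Relabelling codes

module _ {n : ℕ} where

  -- Zero is excluded so that the value at 0 survives, and `v` itself so that `f v`, which
  -- determines the transposition, can still be read off afterwards.
  Lower : Fin n → Fin n → Set
  Lower v u = 0 < toℕ u × u Fin.< v

  lower? : ∀ v u → Dec (Lower v u)
  lower? v u = (0 ℕ.<? toℕ u) ×-dec (u <? v)

  relabel : Fin n → Map n → Map n
  relabel v f u with lower? v u
  ... | yes _ = transpose v (smaller v (f v)) ⟨$⟩ʳ f u
  ... | no  _ = f u

  relabel-lower : ∀ {v u} (f : Map n) → Lower v u →
    relabel v f u ≡ transpose v (smaller v (f v)) ⟨$⟩ʳ f u
  relabel-lower {v} {u} f l with lower? v u
  ... | yes _ = refl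
  ... | no ¬l = contradiction l ¬l

  relabel-other : ∀ {v u} (f : Map n) → ¬ Lower v u → relabel v f u ≡ f u
  relabel-other {v} {u} f ¬l with lower? v u
  ... | yes l = contradiction l ¬l
  ... | no _  = refl

  relabel-cong : ∀ v {f g : Map n} → f ≗ g → relabel v f ≗ relabel v g
  relabel-cong v f≗g u with lower? v u
  ... | yes _ = cong₂ (λ w x → transpose v (smaller v w) ⟨$⟩ʳ x) (f≗g v) (f≗g u)
  ... | no  _ = f≗g u

  relabel-fixed : ∀ v (f : Map n) → relabel v f v ≡ f v
  relabel-fixed v f = relabel-other f (λ (_ , v<v) → ℕ.<-irrefl refl v<v)

  relabel-involutive : ∀ v (f : Map n) → relabel v (relabel v f) ≗ f
  relabel-involutive v f u = helper (lower? v u)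
    where
    open ≡-Reasoning
    helper : Dec (Lower v u) → relabel v (relabel v f) u ≡ f u
    helper (no ¬l) = trans (relabel-other (relabel v f) ¬l) (relabel-other f ¬l)
    helper (yes l) = begin
      relabel v (relabel v f) u
        ≡⟨ relabel-lower (relabel v f) l ⟩
      transpose v (smaller v (relabel v f v)) ⟨$⟩ʳ relabel v f u
        ≡⟨ cong₂ (λ w x → transpose v (smaller v w) ⟨$⟩ʳ x) (relabel-fixed v f) (relabel-lower f l) ⟩
      transpose v (smaller v (f v)) ⟨$⟩ʳ (transpose v (smaller v (f v)) ⟨$⟩ʳ f u)
        ≡⟨ transpose-involutive v (smaller v (f v)) (f u) ⟩
      f u ∎

module _ (N : ℕ) where

  V : Set
  V = Fin (suc N)

  last : V
  last = fromℕ N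

  IsCode : Map (suc N) → Set
  IsCode f = f zero ≡ zero × f last ≡ zero

  ≤last : ∀ (u : V) → toℕ u ≤ toℕ last
  ≤last u = subst (toℕ u ≤_) (sym (toℕ-fromℕ N)) (toℕ≤pred[n] u)

  -- Neither prescribed value is touched: 0 is excluded from `Lower`, and no `v` exceeds the last
  -- vertex.
  relabel-code : ∀ v {f} → IsCode f → IsCode (relabel v f)
  relabel-code v {f} (f0 , fl) = trans (relabel-other {v = v} f (λ { (() , _) })) f0
    , trans (relabel-other f (λ (_ , l<v) → ℕ.<⇒≱ l<v (≤last v))) fl

  relabelling : ∀ k → k < suc N → Inverse (Maps IsCode) (Maps IsCode)
  relabelling zero    _    = Identity.inverse _
  relabelling (suc k) k<N = Compose.inverse (relabelling k (ℕ.<⇒≤ k<N))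
    (involution (relabel v) (relabel-cong v) (relabel-involutive v) (relabel-code v) (relabel-code v))
    where v = fromℕ< k<N

  -- Induction on `k`, with `σ` followed by the transposition `τ` of the new stage `v`, which is k +
  -- 1. Below `v` the stage applies `τ` to the values. At `v` the head is at least `v`, so `σ` fixes
  -- it by the last clause, and `swap-larger` shows that `τ` carries it to the value kept at `v`.
  relabelling-heads : ∀ k (k<N : k < suc N) c →
    let f = proj₁ c
        g = proj₁ (Inverse.to (relabelling k k<N) c)
    in Σ (Permutation′ (suc N)) λ σ →
       (∀ u → 0 < toℕ u → toℕ u ≤ k → g u ≡ σ ⟨$⟩ʳ heads f u)
     × (∀ u → k < toℕ u → g u ≡ f u)
     × (∀ x → k < toℕ x → σ ⟨$⟩ʳ x ≡ x)
  relabelling-heads zero    _   c =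
    Perm.id , (λ u 0<u u≤0 → contradiction u≤0 (ℕ.<⇒≱ 0<u)) , (λ _ _ → refl) , (λ _ _ → refl)
  relabelling-heads (suc k) k<N c = σ ∘ₚ τ , below , above , fixed
    where
    f g g′ : Map (suc N)
    f  = proj₁ c
    g  = proj₁ (Inverse.to (relabelling k (ℕ.<⇒≤ k<N)) c)
    g′ = proj₁ (Inverse.to (relabelling (suc k) k<N) c)
    ih = relabelling-heads k (ℕ.<⇒≤ k<N) c
    σ = proj₁ ih
    ih-below = proj₁ (proj₂ ih)
    ih-above = proj₁ (proj₂ (proj₂ ih))
    ih-fixed = proj₂ (proj₂ (proj₂ ih))
    v : V
    v = fromℕ< k<N
    v≡ : toℕ v ≡ suc k
    v≡ = toℕ-fromℕ< k<N
    k<v : k < toℕ v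
    k<v = ℕ.≤-reflexive (sym v≡)
    τ : Permutation′ (suc N)
    τ = transpose v (smaller v (g v))
    gv≡fv : g v ≡ f v
    gv≡fv = ih-above v k<v
    at-v : g′ v ≡ τ ⟨$⟩ʳ (σ ⟨$⟩ʳ heads f v)
    at-v = begin
      g′ v                                            ≡⟨ relabel-fixed v g ⟩
      g v                                             ≡⟨ swap-larger v (g v) ⟨
      τ ⟨$⟩ʳ larger v (g v)                           ≡⟨ cong (λ w → τ ⟨$⟩ʳ larger v w) gv≡fv ⟩
      τ ⟨$⟩ʳ heads f v                                ≡⟨ cong (τ ⟨$⟩ʳ_) (ih-fixed _ (ℕ.<-≤-trans k<v (≤-larger v (f v)))) ⟨
      τ ⟨$⟩ʳ (σ ⟨$⟩ʳ heads f v)                       ∎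
      where open ≡-Reasoning
    below : ∀ u → 0 < toℕ u → toℕ u ≤ suc k → g′ u ≡ τ ⟨$⟩ʳ (σ ⟨$⟩ʳ heads f u)
    below u 0<u u≤1+k with ℕ.m≤n⇒m<n∨m≡n u≤1+k
    ... | inj₁ u<1+k = trans
            (relabel-lower g (0<u , subst (toℕ u <_) (sym v≡) u<1+k))
            (cong (τ ⟨$⟩ʳ_) (ih-below u 0<u (ℕ.≤-pred u<1+k)))
    ... | inj₂ u≡1+k = subst (λ w → g′ w ≡ τ ⟨$⟩ʳ (σ ⟨$⟩ʳ heads f w))
            (toℕ-injective (trans v≡ (sym u≡1+k))) at-v
    above : ∀ u → suc k < toℕ u → g′ u ≡ f u
    above u 1+k<u = trans
      (relabel-other g (λ (_ , u<v) → ℕ.<-asym 1+k<u (subst (toℕ u <_) v≡ u<v)))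
      (ih-above u (ℕ.<-trans ℕ.≤-refl 1+k<u))
    fixed : ∀ x → suc k < toℕ x → τ ⟨$⟩ʳ (σ ⟨$⟩ʳ x) ≡ x
    fixed x 1+k<x = trans
      (cong (τ ⟨$⟩ʳ_) (ih-fixed x (ℕ.<-trans ℕ.≤-refl 1+k<x)))
      (transpose-other v _ (≢-sym (<⇒≢ v<x)) (≢-sym (<⇒≢ (ℕ.≤-<-trans (smaller-≤ v (g v)) v<x))))
      where
      v<x : v Fin.< x
      v<x = subst (_< toℕ x) (sym v≡) 1+k<x

  codes : Inverse (Maps IsCode) (Maps IsCode)
  codes = relabelling N ℕ.≤-refl

  -- Off the root `g` is `σ` after `heads f`, so the fibre of `heads f` over `v` is the fibre of `g`
  -- over the image of `v` under `σ`.
  codes-children : ∀ c i →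
    mult (children zero (heads (proj₁ c))) i ≡ mult (children zero (proj₁ (Inverse.to codes c))) i
  codes-children c i = begin
    mult (children zero (heads f)) i            ≡⟨ mult-cong _ _ pointwise i ⟩
    mult (children zero g ∘ (σ ⟨$⟩ʳ_)) i        ≡⟨ mult-permute (children zero g) σ i ⟩
    mult (children zero g) i                    ∎
    where
    open ≡-Reasoning
    f g : Map (suc N)
    f = proj₁ c
    g = proj₁ (Inverse.to codes c)
    inv = relabelling-heads N ℕ.≤-refl c
    σ : Permutation′ (suc N)
    σ = proj₁ inv
    g≡σh : ∀ u → u ≢ zero → g u ≡ σ ⟨$⟩ʳ heads f u
    g≡σh u u≢0 = proj₁ (proj₂ inv) u (ℕ.n≢0⇒n>0 (u≢0 ∘ toℕ-injective)) (toℕ≤pred[n] u)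
    pointwise : ∀ v → children zero (heads f) v ≡ children zero g (σ ⟨$⟩ʳ v)
    pointwise v = trans (sym (children-permuteᵛ zero (heads f) σ v))
                        (sym (children-cong zero g ((σ ⟨$⟩ʳ_) ∘ heads f) g≡σh (σ ⟨$⟩ʳ v)))

-- Merging cycles

module _ {n : ℕ} where

  data _⊢_⇝_ (f : Map n) : Fin n → Fin n → Set where
    stop : ∀ {u} → f ⊢ u ⇝ u
    up   : ∀ {u w} → f ⊢ f u ⇝ w → f ⊢ u ⇝ w

  ⇝-trans : ∀ {f u v w} → f ⊢ u ⇝ v → f ⊢ v ⇝ w → f ⊢ u ⇝ w
  ⇝-trans stop   q = q
  ⇝-trans (up p) q = up (⇝-trans p q)

  -- These are the parent maps of trees rooted at `r`, with the root as its own parent.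
  ReachesRoot : Fin n → Map n → Set
  ReachesRoot r f = f r ≡ r × (∀ v → f ⊢ v ⇝ r)

  first-step : ∀ {f u w} → f ⊢ u ⇝ w → u ≡ w ⊎ f ⊢ f u ⇝ w
  first-step stop   = inj₁ refl
  first-step (up p) = inj₂ p

  rotate : ∀ {f v} → f ⊢ f v ⇝ v → f ⊢ f (f v) ⇝ f v
  rotate {f} {v} cycle with first-step cycle
  ... | inj₁ fv≡v = subst (f ⊢_⇝ f v) (sym (cong f fv≡v)) stop
  ... | inj₂ p    = ⇝-trans p (up stop)

  from-fixed : ∀ {f r w} → f r ≡ r → f ⊢ r ⇝ w → w ≡ r
  from-fixed {f} fr≡r p = go p refl
    where
    go : ∀ {u w} → f ⊢ u ⇝ w → u ≡ _ → w ≡ _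
    go stop   u≡r = u≡r
    go (up p) u≡r = go p (trans (cong f u≡r) fr≡r)

  -- The cycle is rotated along the path from `v` to `r`. By recursion `f v` is `r`; since `r` is
  -- fixed, its orbit contains nothing else, so `v` is `r` as well.
  acyclic : ∀ {r f} → ReachesRoot r f → ∀ {v} → f ⊢ f v ⇝ v → v ≡ r
  acyclic {r} {f} (fr≡r , reach) {v} = go (reach v)
    where
    go : ∀ {v} → f ⊢ v ⇝ r → f ⊢ f v ⇝ v → v ≡ r
    go stop       _     = refl
    go {v} (up p) cycle = from-fixed fr≡r (subst (f ⊢_⇝ v) (go p (rotate cycle)) cycle)

-- Orbits with small vertices skipped

module _ {n : ℕ} where

  -- The first vertex outside {1, …, k} on the f-orbit of x; a junk value if that orbit stays
  -- inside, which NoCycles f k excludes.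
  elim : Map n → ℕ → Map n
  elim f zero    x = x
  elim f (suc k) x with toℕ (elim f k x) ℕ.≟ suc k
  ... | yes _ = elim f k (f (elim f k x))
  ... | no  _ = elim f k x

  elim-hit : ∀ {f k} x → toℕ (elim f k x) ≡ suc k → elim f (suc k) x ≡ elim f k (f (elim f k x))
  elim-hit {f} {k} x eq with toℕ (elim f k x) ℕ.≟ suc k
  ... | yes _  = refl
  ... | no neq = contradiction eq neq

  elim-miss : ∀ {f k} x → toℕ (elim f k x) ≢ suc k → elim f (suc k) x ≡ elim f k x
  elim-miss {f} {k} x neq with toℕ (elim f k x) ℕ.≟ suc k
  ... | yes eq = contradiction eq neq
  ... | no _   = refl

  -- Only values at vertices up to `k` are ever consulted, so an exchange of values at two larger
  -- vertices is invisible to `elim f k`.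
  elim-cong : ∀ {f g} k → (∀ u → toℕ u ≤ k → f u ≡ g u) → elim f k ≗ elim g k
  elim-cong         zero    f≡g x = refl
  elim-cong {f} {g} (suc k) f≡g x = helper (toℕ (elim f k x) ℕ.≟ suc k)
    where
    open ≡-Reasoning
    ih : elim f k ≗ elim g k
    ih = elim-cong k (λ u u≤k → f≡g u (ℕ.m≤n⇒m≤1+n u≤k))
    helper : Dec (toℕ (elim f k x) ≡ suc k) → elim f (suc k) x ≡ elim g (suc k) x
    helper (yes eq) = begin
      elim f (suc k) x             ≡⟨ elim-hit x eq ⟩
      elim f k (f (elim f k x))    ≡⟨ ih _ ⟩
      elim g k (f (elim f k x))    ≡⟨ cong (elim g k) (f≡g _ (ℕ.≤-reflexive eq)) ⟩
      elim g k (g (elim f k x))    ≡⟨ cong (elim g k ∘ g) (ih x) ⟩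
      elim g k (g (elim g k x))    ≡⟨ elim-hit x (trans (cong toℕ (sym (ih x))) eq) ⟨
      elim g (suc k) x             ∎
    helper (no neq) = begin
      elim f (suc k) x    ≡⟨ elim-miss x neq ⟩
      elim f k x          ≡⟨ ih x ⟩
      elim g k x          ≡⟨ elim-miss x (neq ∘ trans (cong toℕ (ih x))) ⟨
      elim g (suc k) x    ∎

  elim-above : ∀ f k {x} → k < toℕ x → elim f k x ≡ x
  elim-above f zero    _   = refl
  elim-above f (suc k) {x} k<x = trans (elim-miss x (λ eq → ℕ.<⇒≢ k<x (sym (trans (cong toℕ (sym ih)) eq)))) ih
    where
    ih = elim-above f k (ℕ.<-trans ℕ.≤-refl k<x)

  elim-⇝ : ∀ f k x → f ⊢ x ⇝ elim f k x
  elim-⇝ f zero    x = stop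
  elim-⇝ f (suc k) x with toℕ (elim f k x) ℕ.≟ suc k
  ... | yes _ = ⇝-trans (elim-⇝ f k x) (up (elim-⇝ f k _))
  ... | no  _ = elim-⇝ f k x

  elim-source : ∀ f k x → toℕ x ≤ k ⊎ elim f k x ≡ x
  elim-source f k x with toℕ x ℕ.≤? k
  ... | yes x≤k = inj₁ x≤k
  ... | no x≰k  = inj₂ (elim-above f k (ℕ.≰⇒> x≰k))

  -- A cycle with maximum `v`, which is j + 1, leaves `v` and comes back through vertices in {1,
  -- ..., j}; `elim f j` started at `f v` detects this by ending at `v`.
  NoCycles : Map n → ℕ → Set
  NoCycles f k = ∀ j v → j < k → toℕ v ≡ suc j → elim f j (f v) ≢ v

  -- After a visit to k + 1 the orbit is continued once from its image. Ending at k + 1 again would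
  -- make that vertex the maximum of a cycle, against the last instance of `NoCycles`.
  elim-target : ∀ f k → NoCycles f k → ∀ x → toℕ (elim f k x) ≡ 0 ⊎ k < toℕ (elim f k x)
  elim-target f zero    _    x with toℕ x
  ... | zero  = inj₁ refl
  ... | suc _ = inj₂ (s≤s z≤n)
  elim-target f (suc k) none x = helper (toℕ (elim f k x) ℕ.≟ suc k)
    where
    ih : ∀ y → toℕ (elim f k y) ≡ 0 ⊎ k < toℕ (elim f k y)
    ih = elim-target f k (λ j v j<k → none j v (ℕ.m<n⇒m<1+n j<k))
    strict : ∀ {y} → toℕ y ≡ 0 ⊎ k < toℕ y → toℕ y ≢ suc k → toℕ y ≡ 0 ⊎ suc k < toℕ y
    strict (inj₁ y≡0) _     = inj₁ y≡0
    strict (inj₂ k<y) y≢1+k = inj₂ (ℕ.≤∧≢⇒< k<y (≢-sym y≢1+k))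
    helper : Dec (toℕ (elim f k x) ≡ suc k) →
             toℕ (elim f (suc k) x) ≡ 0 ⊎ suc k < toℕ (elim f (suc k) x)
    helper (yes eq) rewrite elim-hit x eq =
      strict (ih _) (λ eq′ → none k (elim f k x) ℕ.≤-refl eq (toℕ-injective (trans eq′ (sym eq))))
    helper (no neq) rewrite elim-miss {f} {k} x neq = strict (ih x) neq

module _ (N : ℕ) where

  private
    s : V N
    s = last N

  elim-zero : ∀ (f : Map (suc N)) k → elim f k zero ≡ zero
  elim-zero f zero = refl
  elim-zero f (suc k) = trans (elim-miss {f = f} {k = k} zero (λ eq → ℕ.0≢1+n (trans (cong toℕ (sym (elim-zero f k))) eq))) (elim-zero f k)

  -- The orbit of N reaches 0 with all intermediate vertices at most k, and every cycle through
  -- a vertex other than 0 has maximum greater than k. Hence k = 0 gives codes, and k = N - 1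
  -- gives parent maps of trees.
  Partial : ℕ → Map (suc N) → Set
  Partial k f = f zero ≡ zero × elim f k (f s) ≡ zero × NoCycles f k

  module Step (k : ℕ) (k<N : suc k < N) where

    v : V N
    v = fromℕ< (ℕ.m<n⇒m<1+n k<N)

    v≡1+k : toℕ v ≡ suc k
    v≡1+k = toℕ-fromℕ< (ℕ.m<n⇒m<1+n k<N)

    k<v : k < toℕ v
    k<v = ℕ.≤-reflexive (sym v≡1+k)

    v<s : v Fin.< s
    v<s = subst₂ _<_ (sym v≡1+k) (sym (toℕ-fromℕ N)) k<N

    π : Permutation′ (suc N)
    π = transpose s v

    π-low : ∀ {u} → toℕ u ≤ k → π ⟨$⟩ʳ u ≡ u
    π-low u≤k = transpose-other s v (<⇒≢ (ℕ.≤-<-trans u≤k (ℕ.<-trans k<v v<s))) (<⇒≢ (ℕ.≤-<-trans u≤k k<v))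

    exchange : Map (suc N) → Map (suc N)
    exchange f = f ∘ (π ⟨$⟩ʳ_)

    exchange-s : ∀ f → exchange f s ≡ f v
    exchange-s f = cong f (transposeˡ s v)

    exchange-v : ∀ f → exchange f v ≡ f s
    exchange-v f = cong f (transposeʳ s v)

    exchange-involutive : ∀ f → exchange (exchange f) ≗ f
    exchange-involutive f u = cong f (transpose-involutive s v u)

    elim-exchange : ∀ f {j} → j ≤ k → elim (exchange f) j ≗ elim f j
    elim-exchange f {j} j≤k = elim-cong j (λ u u≤j → cong f (π-low (ℕ.≤-trans u≤j j≤k)))

    -- The two alternatives trade places under `exchange`, so the test answers alike before and
    -- after; hence `φ` is self-inverse on all maps.
    Flips : Map (suc N) → Set
    Flips f = elim f k (f s) ≡ v ⊎ elim f k (f v) ≡ v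

    flips? : ∀ f → Dec (Flips f)
    flips? f = (elim f k (f s) ≟ v) ⊎-dec (elim f k (f v) ≟ v)

    flips-cong : ∀ {f g} → f ≗ g → Flips f → Flips g
    flips-cong {f} {g} f≗g = [ inj₁ ∘ transfer s , inj₂ ∘ transfer v ]′
      where
      transfer : ∀ u → elim f k (f u) ≡ v → elim g k (g u) ≡ v
      transfer u = trans (sym (trans (elim-cong k (λ w _ → f≗g w) (f u)) (cong (elim g k) (f≗g u))))

    flips-exchange : ∀ {f} → Flips f → Flips (exchange f)
    flips-exchange {f} = [ (λ eq → inj₂ (trans (trans (elim-exchange f ℕ.≤-refl _) (cong (elim f k) (exchange-v f))) eq))
                         , (λ eq → inj₁ (trans (trans (elim-exchange f ℕ.≤-refl _) (cong (elim f k) (exchange-s f))) eq)) ]′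

    -- For f in Partial k only the second alternative of Flips f is possible (v is the maximum of a
    -- cycle), and in Partial (suc k) only the first one (v lies on the path from s to 0).
    φ : Map (suc N) → Map (suc N)
    φ f with flips? f
    ... | yes _ = exchange f
    ... | no  _ = f

    φ-flips : ∀ {f} → Flips f → φ f ≡ exchange f
    φ-flips {f} p with flips? f
    ... | yes _ = refl
    ... | no ¬p = contradiction p ¬p

    φ-fixes : ∀ {f} → ¬ Flips f → φ f ≡ f
    φ-fixes {f} ¬p with flips? f
    ... | yes p = contradiction p ¬p
    ... | no _  = refl

    φ-cong : ∀ {f g} → f ≗ g → φ f ≗ φ g
    φ-cong {f} {g} f≗g u with flips? f
    ... | yes p = trans (f≗g _) (cong-app (sym (φ-flips (flips-cong f≗g p))) u)
    ... | no ¬p = trans (f≗g u) (cong-app (sym (φ-fixes (¬p ∘ flips-cong (λ w → sym (f≗g w))))) u)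

    φ-involutive : ∀ f → φ (φ f) ≗ f
    φ-involutive f u with flips? f
    ... | yes p = trans (cong-app (φ-flips (flips-exchange p)) u) (exchange-involutive f u)
    ... | no ¬p = cong-app (φ-fixes ¬p) u

    0≢v : zero ≢ v
    0≢v 0≡v = ℕ.0≢1+n (trans (cong toℕ 0≡v) v≡1+k)

    is-v : ∀ {w} → toℕ w ≡ suc k → w ≡ v
    is-v w≡1+k = toℕ-injective (trans w≡1+k (sym v≡1+k))

    elim-at-v : ∀ {f x} → elim f k x ≡ v → elim f (suc k) x ≡ elim f k (f v)
    elim-at-v {f} {x} eq = trans (elim-hit x (trans (cong toℕ eq) v≡1+k)) (cong (elim f k ∘ f) eq)

    elim-off-v : ∀ {f x} → elim f k x ≢ v → elim f (suc k) x ≡ elim f k x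
    elim-off-v {f} {x} neq = elim-miss x (neq ∘ is-v)

    NoCycles-suc : ∀ {f} → NoCycles f k → elim f k (f v) ≢ v → NoCycles f (suc k)
    NoCycles-suc {f} none at-v j w j<1+k w≡1+j with ℕ.m≤n⇒m<n∨m≡n (ℕ.≤-pred j<1+k)
    ... | inj₁ j<k  = none j w j<k w≡1+j
    ... | inj₂ refl = subst (λ x → elim f k (f x) ≢ x) (sym (is-v w≡1+j)) at-v

    NoCycles-exchange : ∀ {f} → NoCycles f k → NoCycles (exchange f) k
    NoCycles-exchange {f} none j w j<k w≡1+j eq = none j w j<k w≡1+j
      (trans (cong (elim f j) (sym (cong f (π-low (subst (_≤ k) (sym w≡1+j) j<k)))))
             (trans (sym (elim-exchange f (ℕ.<⇒≤ j<k) _)) eq))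

    exchange-zero : ∀ f → exchange f zero ≡ f zero
    exchange-zero f = cong f (π-low z≤n)

    elim-exchange-s : ∀ f → elim (exchange f) k (exchange f s) ≡ elim f k (f v)
    elim-exchange-s f = trans (elim-exchange f ℕ.≤-refl _) (cong (elim f k) (exchange-s f))

    elim-exchange-v : ∀ f → elim (exchange f) k (exchange f v) ≡ elim f k (f s)
    elim-exchange-v f = trans (elim-exchange f ℕ.≤-refl _) (cong (elim f k) (exchange-v f))

    -- If `v` is the maximum of a cycle, the exchange sends `s` into that cycle, round to `v`, and
    -- from there along the old path of `s` to 0.
    forward : ∀ {f} → Partial k f → Partial (suc k) (φ f)
    forward {f} (f0 , fs , none) with flips? f
    ... | no ¬p = f0 , trans (elim-off-v (¬p ∘ inj₁)) fs , NoCycles-suc none (¬p ∘ inj₂)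
    ... | yes (inj₁ fs≡v) = contradiction (trans (sym fs) fs≡v) 0≢v
    ... | yes (inj₂ fv≡v) =
        trans (exchange-zero f) f0
      , trans (elim-at-v (trans (elim-exchange-s f) fv≡v)) (trans (elim-exchange-v f) fs)
      , NoCycles-suc (NoCycles-exchange none) (λ eq → 0≢v (trans (sym (trans (elim-exchange-v f) fs)) eq))

    -- If the path from `s` passes `v`, the exchange lets `s` jump to the successor of `v`, and the
    -- part of the path from `f s` to `v` closes into a cycle with maximum `v`.
    backward : ∀ {f} → Partial (suc k) f → Partial k (φ f)
    backward {f} (f0 , fs , none) with flips? f
    ... | no ¬p = f0 , trans (sym (elim-off-v (¬p ∘ inj₁))) fs , λ j w j<k → none j w (ℕ.m<n⇒m<1+n j<k)
    ... | yes (inj₂ fv≡v) = contradiction fv≡v (none k v ℕ.≤-refl v≡1+k)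
    ... | yes (inj₁ fs≡v) =
        trans (exchange-zero f) f0
      , trans (elim-exchange-s f) (trans (sym (elim-at-v fs≡v)) fs)
      , NoCycles-exchange (λ j w j<k → none j w (ℕ.m<n⇒m<1+n j<k))

    merge : Inverse (Maps (Partial k)) (Maps (Partial (suc k)))
    merge = involution φ φ-cong φ-involutive forward backward

    φ-children : ∀ f → children zero (φ f) ≗ children zero f
    φ-children f u with flips? f
    ... | yes _ = children-permuteᵘ zero f π (π-low z≤n) u
    ... | no  _ = refl

    -- When s and v exchange values, both values are at most v ≤ s, so that the heads stay s and v.
    φ-heads : ∀ {f} → Partial k f → heads (φ f) ≗ heads f
    φ-heads {f} (f0 , fs , none) with flips? f
    ... | no  _           = λ _ → refl
    ... | yes (inj₁ fs≡v) = contradiction (trans (sym fs) fs≡v) 0≢v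
    ... | yes (inj₂ fv≡v) = go
      where
      fs≤v : f s Fin.≤ v
      fs≤v with elim-source f k (f s)
      ... | inj₁ fs≤k = ℕ.≤-trans fs≤k (ℕ.<⇒≤ k<v)
      ... | inj₂ same = subst (Fin._≤ v) (trans (sym fs) same) z≤n
      fv≤v : f v Fin.≤ v
      fv≤v with elim-source f k (f v)
      ... | inj₁ fv≤k = ℕ.≤-trans fv≤k (ℕ.<⇒≤ k<v)
      ... | inj₂ same = ℕ.≤-reflexive (cong toℕ (trans (sym same) fv≡v))
      go : heads (exchange f) ≗ heads f
      go u with u ≟ s
      ... | yes refl = trans (larger-≤ (≤last N (f v))) (sym (larger-≤ (≤last N (f s))))
      ... | no _ with u ≟ v
      ...   | yes refl = trans (larger-≤ fs≤v) (sym (larger-≤ fv≤v))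
      ...   | no _     = refl

  merging : ∀ k → k < N → Inverse (Maps (Partial 0)) (Maps (Partial k))
  merging zero    _   = Identity.inverse (Maps (Partial 0))
  merging (suc k) k<N = Compose.inverse (merging k (ℕ.<⇒≤ k<N)) (Step.merge k k<N)

  merging-children : ∀ k (k<N : k < N) c →
    children zero (proj₁ (Inverse.to (merging k k<N) c)) ≗ children zero (proj₁ c)
  merging-children zero    _   c u = refl
  merging-children (suc k) k<N c u =
    trans (Step.φ-children k k<N _ u) (merging-children k (ℕ.<⇒≤ k<N) c u)

  merging-heads : ∀ k (k<N : k < N) c → heads (proj₁ (Inverse.to (merging k k<N) c)) ≗ heads (proj₁ c)
  merging-heads zero    _   c u = refl
  merging-heads (suc k) k<N c u = trans
    (Step.φ-heads k k<N (proj₂ (Inverse.to (merging k (ℕ.<⇒≤ k<N)) c)) u)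
    (merging-heads k (ℕ.<⇒≤ k<N) c u)

-- Codes and parent maps rooted at 0

module _ (M : ℕ) where

  private
    N : ℕ
    N = suc M
    s : V N
    s = last N

  zero≢s : zero ≢ s
  zero≢s ()

  -- Once 1, ..., M are eliminated only 0 and `s` remain, so every orbit meets one of them, and `s`
  -- leads to 0.
  partial-reaches : ∀ {f} → Partial N M f → ReachesRoot zero f
  partial-reaches {f} (f0 , fs , none) = f0 , reach
    where
    reach-s : f ⊢ s ⇝ zero
    reach-s = up (subst (f ⊢ f s ⇝_) fs (elim-⇝ f M (f s)))
    reach : ∀ v → f ⊢ v ⇝ zero
    reach v with elim-target f M none v
    ... | inj₁ e≡0 = subst (f ⊢ v ⇝_) (toℕ-injective e≡0) (elim-⇝ f M v)
    ... | inj₂ M<e = ⇝-trans (subst (f ⊢ v ⇝_) e≡s (elim-⇝ f M v)) reach-s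
      where
      e≡s : elim f M v ≡ s
      e≡s = toℕ-injective (ℕ.≤-antisym (≤last N _) (subst (_≤ toℕ (elim f M v)) (sym (toℕ-fromℕ N)) M<e))

  -- A violation of `NoCycles`, or an elimination from `f s` ending at `s`, would be a cycle through
  -- a vertex other than the root.
  reaches-partial : ∀ {f} → ReachesRoot zero f → Partial N M f
  reaches-partial {f} reaches@(f0 , reach) = f0 , fs , none
    where
    none : NoCycles f M
    none j v _ v≡1+j eq = ℕ.0≢1+n (trans (cong toℕ (sym v≡0)) v≡1+j)
      where
      v≡0 : v ≡ zero
      v≡0 = acyclic reaches (subst (f ⊢ f v ⇝_) eq (elim-⇝ f j (f v)))
    fs : elim f M (f s) ≡ zero
    fs with elim-target f M none (f s)
    ... | inj₁ e≡0 = toℕ-injective e≡0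
    ... | inj₂ M<e = contradiction (sym (acyclic reaches (subst (f ⊢ f s ⇝_) e≡s (elim-⇝ f M (f s))))) zero≢s
      where
      e≡s : elim f M (f s) ≡ s
      e≡s = toℕ-injective (ℕ.≤-antisym (≤last N _) (subst (_≤ toℕ (elim f M (f s))) (sym (toℕ-fromℕ N)) M<e))

  same : ∀ {P Q : Map (suc N) → Set} → (∀ {f} → P f → Q f) → (∀ {f} → Q f → P f) →
    Inverse (Maps P) (Maps Q)
  same = involution (λ f → f) (λ f≗g → f≗g) (λ _ _ → refl)

  -- `elim f 0` is the identity and `NoCycles f 0` is vacuous.
  codePartial : Inverse (Maps (IsCode N)) (Maps (Partial N 0))
  codePartial = same (λ (f0 , fs) → f0 , fs , λ _ _ ()) (λ (f0 , fs , _) → f0 , fs)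

  codeTree : Inverse (Maps (IsCode N)) (Maps (ReachesRoot zero))
  codeTree = Compose.inverse codePartial
    (Compose.inverse (merging N M ℕ.≤-refl) (same partial-reaches reaches-partial))

-- Trees and parent maps

data Trail {n} (R : Rel (Fin n) 0ℓ) : Fin n → List (Fin n) → Fin n → Set where
  stop : ∀ {u} → Trail R u (u ∷ []) u
  _∷_  : ∀ {u v w vs} → R u v → Trail R v vs w → Trail R u (u ∷ vs) w

module _ {n : ℕ} {R : Rel (Fin n) 0ℓ} where

  -- The last component lets the suffix inherit the avoidance of a vertex that the whole trail
  -- avoids.
  trail-suffix : ∀ {u v w vs} → Trail R v vs w → Unique vs → u ∈ vs →
    ∃ λ us → Trail R u us w × Unique us × (∀ {x} → All (x ≢_) vs → All (x ≢_) us)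
  trail-suffix stop    unique         (here refl) = _ , stop , unique , λ p → p
  trail-suffix (e ∷ t) unique         (here refl) = _ , (e ∷ t) , unique , λ p → p
  trail-suffix (e ∷ t) (_ ∷ unique)   (there u∈)  with trail-suffix t unique u∈
  ... | us , t′ , unique′ , sub = us , t′ , unique′ , λ { (_ ∷ p) → sub p }

  loop-erase : ∀ {u w} → Star R u w → ∃ λ vs → Trail R u vs w × Unique vs
  loop-erase ε = _ , stop , ([] ∷ [])
  loop-erase {u} (e ◅ p) with loop-erase p
  ... | vs , t , unique with member? _≟_ u vs
  -- The start recurs later, so the loop is cut by keeping only the suffix from that recurrence.
  ...   | yes u∈ = let us , t′ , unique′ , _ = trail-suffix t unique u∈ in us , t′ , unique′
  ...   | no u∉  = u ∷ vs , e ∷ t , ¬Any⇒All¬ vs u∉ ∷ unique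

  trail-source : ∀ {u w vs} → Trail R u vs w → u ∈ vs
  trail-source stop    = here refl
  trail-source (e ∷ t) = here refl

  trail-target : ∀ {u w vs} → Trail R u vs w → w ∈ vs
  trail-target stop    = here refl
  trail-target (e ∷ t) = there (trail-target t)

Avoiding : ∀ {n} → Graph n → Fin n → Rel (Fin n) 0ℓ
Avoiding G x u v = Adj G u v × x ≢ u × x ≢ v

trail-avoids : ∀ {n} {G : Graph n} {x u w vs} → Trail (Adj G) u vs w → All (x ≢_) vs →
  Star (Avoiding G x) u w
trail-avoids stop    _         = ε
trail-avoids (e ∷ t) (x≢u ∷ p) = (e , x≢u , All.lookup p (trail-source t)) ◅ trail-avoids t p

Bool-ext : ∀ {a b} → (T a → T b) → (T b → T a) → a ≡ b
Bool-ext {false} {false} _ _ = refl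
Bool-ext {false} {true}  _ q = ⊥-elim (q _)
Bool-ext {true}  {false} p _ = ⊥-elim (p _)
Bool-ext {true}  {true}  _ _ = refl

module _ {n : ℕ} (r : Fin n) where

  Edge : Map n → Fin n → Fin n → Set
  Edge f u v = (u ≢ r × f u ≡ v) ⊎ (v ≢ r × f v ≡ u)

  edge? : ∀ f u v → Dec (Edge f u v)
  edge? f u v = (¬? (u ≟ r) ×-dec (f u ≟ v)) ⊎-dec (¬? (v ≟ r) ×-dec (f v ≟ u))

  _Represents_ : Map n → Graph n → Set
  f Represents G = ∀ u v → (Adj G u v → Edge f u v) × (Edge f u v → Adj G u v)

  -- Induction along the path to the root. The edge between `v` and `f v` belongs to `g` as well. If
  -- `g` directed it from `f v` to `v`, then, the maps agreeing at `f v` by induction, `f` would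
  -- have a cycle of length two.
  represents-unique : ∀ {f g G} → ReachesRoot r f → ReachesRoot r g →
    f Represents G → g Represents G → f ≗ g
  represents-unique {f} {g} {G} reachesᶠ@(fr≡r , reach) reachesᵍ@(gr≡r , _) fG gG v =
    go (reach v) refl
    where
    transfer : ∀ {u v} → Edge f u v → Edge g u v
    transfer {u} {v} = proj₁ (gG u v) ∘ proj₂ (fG u v)
    go : ∀ {v w} → f ⊢ v ⇝ w → w ≡ r → f v ≡ g v
    go stop refl = trans fr≡r (sym gr≡r)
    go {v} (up p) refl with v ≟ r
    ... | yes refl = trans fr≡r (sym gr≡r)
    ... | no v≢r with transfer {v} {f v} (inj₁ (v≢r , refl))
    ...   | inj₁ (_ , gv≡fv) = sym gv≡fv
    ...   | inj₂ (_ , gfv≡v) = contradiction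
              (acyclic reachesᶠ (subst (f ⊢ f v ⇝_) (trans (go p refl) gfv≡v) (up stop))) v≢r

  toGraph : Map n → Graph n
  toGraph f u v = ⌊ edge? f u v ⌋

  toGraph-represented : ∀ f → f Represents toGraph f
  toGraph-represented f u v = toWitness {a? = edge? f u v} , fromWitness {a? = edge? f u v}

  represents-symmetric : ∀ {f G} → f Represents G → ∀ {u v} → Adj G u v → Adj G v u
  represents-symmetric fG {u} {v} = proj₂ (fG v u) ∘ swap ∘ proj₁ (fG u v)

  -- A non-backtracking chain of edges, indexed by its first edge p c and its last edge q z.
  data Chain (f : Map n) : (p c q z : Fin n) → Set where
    single : ∀ {p c} → Edge f p c → Chain f p c p c
    _∷⟨_⟩_ : ∀ {p c d q z} → Edge f p c → p ≢ d → Chain f c d q z → Chain f p c q z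

  -- After a step down from `p` to its child `c`, a step up would return to `p`. So a chain goes up
  -- throughout, first up and finally down, or down throughout, in the order of the alternatives.
  chain-shape : ∀ {f p c q z} → Chain f p c q z →
      (p ≢ r × f p ≡ c × f ⊢ f p ⇝ z)
    ⊎ (f p ≡ c × f z ≡ q)
    ⊎ (z ≢ r × f z ≡ q × f c ≡ p × f ⊢ f z ⇝ p)
  chain-shape (single (inj₁ (p≢r , refl))) = inj₁ (p≢r , refl , stop)
  chain-shape (single (inj₂ (c≢r , refl))) = inj₂ (inj₂ (c≢r , refl , refl , stop))
  chain-shape (inj₁ (p≢r , refl) ∷⟨ _ ⟩ t) with chain-shape t
  ... | inj₁ (_ , _ , c⇝z)                  = inj₁ (p≢r , refl , up c⇝z)
  ... | inj₂ (inj₁ (_ , fz≡q))              = inj₂ (inj₁ (refl , fz≡q))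
  ... | inj₂ (inj₂ (_ , fz≡q , _))          = inj₂ (inj₁ (refl , fz≡q))
  chain-shape (inj₂ (c≢r , refl) ∷⟨ p≢d ⟩ t) with chain-shape t
  ... | inj₁ (_ , fc≡d , _)                 = contradiction fc≡d p≢d
  ... | inj₂ (inj₁ (fc≡d , _))              = contradiction fc≡d p≢d
  ... | inj₂ (inj₂ (z≢r , fz≡q , _ , z⇝c))  = inj₂ (inj₂ (z≢r , fz≡q , refl , ⇝-trans z⇝c (up stop)))

  module _ {f : Map n} {G : Graph n} (reaches : ReachesRoot r f) (fG : f Represents G) where

    private
      edge : ∀ {u v} → Adj G u v → Edge f u v
      edge {u} {v} = proj₁ (fG u v)

    close-chain : ∀ {x p c} ys → Linked (Adj G) (p ∷ c ∷ ys ++ [ x ]) → Unique (p ∷ c ∷ ys) →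
      All (x ≢_) (p ∷ c ∷ ys) → ∃ λ q → q ∈ c ∷ ys × Chain f p c q x
    close-chain []       (e ∷ e′ ∷ [-]) _ (x≢p ∷ _) =
      _ , here refl , (edge e ∷⟨ ≢-sym x≢p ⟩ single (edge e′))
    close-chain (d ∷ ys) (e ∷ es) ((_ ∷ p≢d ∷ _) ∷ unique) (_ ∷ x≢) =
      let q , q∈ , chain = close-chain ys es unique x≢
      in q , there q∈ , (edge e ∷⟨ p≢d ⟩ chain)

    -- A cycle is read as a chain from `x` back to `x`. Up or down throughout, it is a cycle of `f`.
    -- Otherwise the first and the last neighbour of `x` are both `f x`, although they are distinct
    -- vertices of the cycle.
    represents-acyclic : ¬ HasCycle G
    represents-acyclic (x , [] , () , _)
    represents-acyclic (x , _ ∷ [] , s≤s () , _)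
    represents-acyclic (x , a ∷ b ∷ ys , _ , x≢@(_ ∷ x≢b ∷ _) ∷ unique@(a≢ ∷ _) , e ∷ es)
      with close-chain ys es unique x≢
    ... | q , q∈ , chain with chain-shape (edge e ∷⟨ x≢b ⟩ chain)
    ...   | inj₁ (x≢r , _ , x⇝x)            = x≢r (acyclic reaches x⇝x)
    ...   | inj₂ (inj₁ (fx≡a , fx≡q))       = All.lookup a≢ q∈ (trans (sym fx≡a) fx≡q)
    ...   | inj₂ (inj₂ (x≢r , _ , _ , x⇝x)) = x≢r (acyclic reaches x⇝x)

    ascend : ∀ {v w} → f ⊢ v ⇝ w → w ≡ r → Star (Adj G) v r
    ascend stop refl = ε
    ascend {v} (up p) refl with v ≟ r
    ... | yes refl = ε
    ... | no v≢r   = proj₂ (fG v (f v)) (inj₁ (v≢r , refl)) ◅ ascend p refl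

    star⇒walk : ∀ {u v} → Star (Adj G) u v → Walk G u v
    star⇒walk ε       = here
    star⇒walk (e ◅ p) = step e (star⇒walk p)

    represents-tree : IsTree G
    represents-tree =
        (λ u v → Bool-ext (represents-symmetric fG) (represents-symmetric fG))
      , (λ u → Bool-ext {b = false} (irreflexive ∘ edge) ⊥-elim)
      , (λ u v → star⇒walk (ascend (proj₂ reaches u) refl
                 ◅◅ reverse (represents-symmetric fG) (ascend (proj₂ reaches v) refl)))
      , represents-acyclic
      where
      irreflexive : ∀ {u} → Edge f u u → ⊥
      irreflexive {u} (inj₁ (u≢r , fu≡u)) = u≢r (acyclic reaches (subst (f ⊢_⇝ u) (sym fu≡u) stop))
      irreflexive {u} (inj₂ (u≢r , fu≡u)) = u≢r (acyclic reaches (subst (f ⊢_⇝ u) (sym fu≡u) stop))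

  module _ {G : Graph n} (tree : IsTree G) where

    private
      adj-sym : ∀ {u v} → Adj G u v → Adj G v u
      adj-sym {u} {v} = subst T (proj₁ tree u v)

      adj-irrefl : ∀ {u v} → Adj G u v → u ≢ v
      adj-irrefl {u} e refl = subst T (proj₁ (proj₂ tree) u) e

    walk⇒star : ∀ {u v} → Walk G u v → Star (Adj G) u v
    walk⇒star here       = ε
    walk⇒star (step e p) = e ◅ walk⇒star p

    -- The neighbour of `v` on the side of the root, described independently of any chosen path.
    Parent : Fin n → Fin n → Set
    Parent v u = Adj G v u × Star (Avoiding G v) u r

    trail-cycle : ∀ {x y u w vs} → Adj G y u → Trail (Avoiding G x) u vs w → Adj G w x →
      Linked (Adj G) (y ∷ vs ++ [ x ])
    trail-cycle e stop           e′ = e ∷ e′ ∷ [-]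
    trail-cycle e ((a , _) ∷ t)  e′ = e ∷ trail-cycle a t e′

    avoiding-trail : ∀ {x u w vs} → x ≢ u → Trail (Avoiding G x) u vs w → All (x ≢_) vs
    avoiding-trail x≢u stop                   = x≢u ∷ []
    avoiding-trail x≢u ((_ , _ , x≢v) ∷ t)    = x≢u ∷ avoiding-trail x≢v t

    -- Two different parents would be joined, via the root, by a walk avoiding `v`; its loop erasure
    -- closes through `v` to a cycle.
    parent-unique : ∀ {v u u′} → Parent v u → Parent v u′ → u ≡ u′
    parent-unique {v} {u} {u′} (e , p) (e′ , p′) with u ≟ u′
    ... | yes u≡u′ = u≡u′
    ... | no u≢u′ with loop-erase (p ◅◅ reverse (λ (a , v≢ , v≢′) → adj-sym a , v≢′ , v≢) p′)
    ...   | vs , t , unique = contradiction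
              (v , vs , long t , avoiding-trail (adj-irrefl e) t ∷ unique , trail-cycle e t (adj-sym e′))
              (proj₂ (proj₂ (proj₂ tree)))
      where
      long : ∀ {vs} → Trail (Avoiding G v) u vs u′ → 2 ≤ length vs
      long stop             = contradiction refl u≢u′
      long (_ ∷ stop)       = s≤s (s≤s z≤n)
      long (_ ∷ (_ ∷ _))    = s≤s (s≤s z≤n)

    simple-trail : ∀ v → ∃ λ vs → Trail (Adj G) v vs r × Unique vs
    simple-trail v = loop-erase (walk⇒star (proj₁ (proj₂ (proj₂ tree)) v r))

    next : ∀ {v vs} → Trail (Adj G) v vs r → Fin n
    -- The empty trail starts at `r`, so this default makes the root its own parent.
    next stop                = r
    next (_∷_ {v = u} _ _)   = u

    parentMap : Map n
    parentMap v = next (proj₁ (proj₂ (simple-trail v)))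

    next-parent : ∀ {v vs} (t : Trail (Adj G) v vs r) → Unique vs → v ≢ r → Parent v (next t)
    next-parent stop    _            v≢r = contradiction refl v≢r
    next-parent (e ∷ t) (v≢ ∷ _)     _   = e , trail-avoids t v≢

    parentMap-parent : ∀ {v} → v ≢ r → Parent v (parentMap v)
    parentMap-parent {v} = next-parent (proj₁ (proj₂ (simple-trail v))) (proj₂ (proj₂ (simple-trail v)))

    Parent-≢r : ∀ {v u} → v ≢ u → Star (Avoiding G v) u r → v ≢ r
    Parent-≢r v≢u ε                   = v≢u
    Parent-≢r v≢u ((_ , _ , v≢w) ◅ p) = Parent-≢r v≢w p

    parentMap-unique : ∀ {v u} → Parent v u → v ≢ r × parentMap v ≡ u
    parentMap-unique par@(e , p) = v≢r , parent-unique (parentMap-parent v≢r) par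
      where v≢r = Parent-≢r (adj-irrefl e) p

    parentMap-root : parentMap r ≡ r
    parentMap-root with simple-trail r
    ... | _ , stop , _           = refl
    ... | _ , (e ∷ t) , r≢ ∷ _   = contradiction refl (All.lookup r≢ (trail-target t))

    -- The simple trail chosen for `v` is followed throughout. Its tails need not be the trails
    -- chosen for later vertices, but each tail avoids the vertex before it, so `parentMap-unique`
    -- identifies every next vertex as the parent.
    parentMap-reaches : ReachesRoot r parentMap
    parentMap-reaches = parentMap-root , λ v → let _ , t , unique = simple-trail v in go t unique
      where
      go : ∀ {v vs} → Trail (Adj G) v vs r → Unique vs → parentMap ⊢ v ⇝ r
      go stop    _             = stop
      go (e ∷ t) (v≢ ∷ unique) =
        up (subst (parentMap ⊢_⇝ r) (sym (proj₂ (parentMap-unique (e , trail-avoids t v≢)))) (go t unique))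

    -- The direction of an edge depends on whether `u` lies on the simple trail from `v` to the
    -- root. If not, that trail makes `v` the parent of `u`; if so, its suffix from `u` avoids `v`
    -- and makes `u` the parent of `v`.
    parentMap-represents : parentMap Represents G
    parentMap-represents u v = to , [ from , adj-sym ∘ from ]′
      where
      from : ∀ {u v} → u ≢ r × parentMap u ≡ v → Adj G u v
      from (u≢r , refl) = proj₁ (parentMap-parent u≢r)
      along : ∀ {vs} → Adj G u v → Trail (Adj G) v vs r → Unique vs → Dec (u ∈ vs) → Edge parentMap u v
      along {vs} e t _ (no u∉) = inj₁ (parentMap-unique (e , trail-avoids t (¬Any⇒All¬ vs u∉)))
      along e stop    _             (yes (here u≡v)) = contradiction u≡v (adj-irrefl e)
      along e (_ ∷ _) _             (yes (here u≡v)) = contradiction u≡v (adj-irrefl e)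
      along e (_ ∷ t) (v≢ ∷ unique) (yes (there u∈)) =
        let _ , t′ , _ , sub = trail-suffix t unique u∈
        in inj₂ (parentMap-unique (adj-sym e , trail-avoids t′ (sub v≢)))
      to : Adj G u v → Edge parentMap u v
      to e = let vs , t , unique = simple-trail v in along e t unique (member? _≟_ u vs)

  Trees : Setoid 0ℓ 0ℓ
  Trees = record
    { Carrier       = Σ (Graph n) IsTree
    ; _≈_           = λ A B → ∀ u v → proj₁ A u v ≡ proj₁ B u v
    ; isEquivalence = record
      { refl  = λ u v → refl
      ; sym   = λ p u v → sym (p u v)
      ; trans = λ p q u v → trans (p u v) (q u v) } }

  represents-resp : ∀ {f g G} → f ≗ g → f Represents G → g Represents G
  represents-resp f≗g fG u v rewrite sym (f≗g u) | sym (f≗g v) = fG u v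

  represents-determines : ∀ {f G H} → f Represents G → f Represents H → ∀ u v → G u v ≡ H u v
  represents-determines fG fH u v =
    Bool-ext (proj₂ (fH u v) ∘ proj₁ (fG u v)) (proj₂ (fG u v) ∘ proj₁ (fH u v))

  represents-respᴳ : ∀ {f G H} → (∀ u v → G u v ≡ H u v) → f Represents G → f Represents H
  represents-respᴳ G≈H fG u v rewrite sym (G≈H u v) = fG u v

  -- A graph and its rooted parent map determine each other through `Represents`; both inverse laws
  -- are instances of this.
  rooting : Inverse Trees (Maps (ReachesRoot r))
  rooting = record
    { to        = λ (G , tree) → parentMap tree , parentMap-reaches tree
    ; from      = λ (f , reaches) → toGraph f , represents-tree reaches (toGraph-represented f)
    ; to-cong   = λ {(G , tG)} {(H , tH)} G≈H → represents-unique
                    (parentMap-reaches tG) (parentMap-reaches tH)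
                    (represents-respᴳ G≈H (parentMap-represents tG)) (parentMap-represents tH)
    ; from-cong = λ {(f , _)} {(g , _)} f≗g → represents-determines
                    (represents-resp f≗g (toGraph-represented f)) (toGraph-represented g)
    ; inverse   = (λ {(f , reaches)} {(G , tree)} G≈f → represents-unique
                    (parentMap-reaches tree) reaches
                    (represents-respᴳ G≈f (parentMap-represents tree)) (toGraph-represented f))
                , (λ {(G , tree)} {(f , _)} f≗G → represents-determines
                    (represents-resp f≗G (toGraph-represented f)) (parentMap-represents tree)) }

  -- Indegrees read off the parent map

  module _ {f : Map n} {G : Graph n} (reaches : ReachesRoot r f) (fG : f Represents G) (v : Fin n) where

    private
      true⇒edge : ∀ {u} → G u v ≡ true → Edge f u v
      true⇒edge {u} = proj₁ (fG u v) ∘ Equivalence.from T-≡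

      edge⇒true : ∀ {u} → Edge f u v → G u v ≡ true
      edge⇒true {u} = Equivalence.to T-≡ ∘ proj₂ (fG u v)

      parent? : Decidable (λ u → v ≢ r × f v ≡ u)
      parent? u = ¬? (v ≟ r) ×-dec (f v ≟ u)

      child-not-parent : ∀ {u} → u ≢ r × f u ≡ v → ¬ (v ≢ r × f v ≡ u)
      child-not-parent (_ , fu≡v) (v≢r , refl) =
        v≢r (acyclic reaches (subst (f ⊢ f v ⇝_) fu≡v (up stop)))

      smallerChild? : Decidable (λ u → u Fin.< v × u ≢ r × f u ≡ v)
      smallerChild? u = (u <? v) ×-dec child? r f v u

      smallerParent? : Decidable (λ u → u Fin.< v × v ≢ r × f v ≡ u)
      smallerParent? u = (u <? v) ×-dec parent? u

      aboveParent? : Decidable (λ u → u ≡ v × v ≢ r × f v Fin.< v)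
      aboveParent? u = (u ≟ v) ×-dec (¬? (v ≟ r) ×-dec (f v <? v))

      parent≢ : v ≢ r → f v ≢ v
      parent≢ v≢r fv≡v = v≢r (acyclic reaches (subst (f ⊢_⇝ v) (sym fv≡v) stop))

      -- Each side counts at most one vertex, `f v` on the left and `v` on the right, under the same
      -- condition; the transposition of the two matches them.
      count-smallerParent : count smallerParent? ≡ count aboveParent?
      count-smallerParent = trans
        (count-cong smallerParent? (aboveParent? ∘ (π ⟨$⟩ʳ_))
          (λ { (u<v , v≢r , refl) → transposeʳ v (f v) , v≢r , u<v })
          (λ (πu≡v , v≢r , fv<v) →
             let u≡fv = permutation-injective π (trans πu≡v (sym (transposeʳ v (f v))))
             in subst (Fin._< v) (sym u≡fv) fv<v , v≢r , sym u≡fv))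
        (count-permute aboveParent? π)
        where π = transpose v (f v)

    -- The smaller neighbours of `v` are its smaller children and possibly its parent. The smaller
    -- children have head `v`, and a smaller parent is traded for `v` itself, whose own edge then
    -- points back to `v`.
    localIndeg-children : localIndeg G v ≡ children r (heads f) v
    localIndeg-children = begin
      localIndeg G v
        ≡⟨ count-cong (λ u → (toℕ u ℕ.<? toℕ v) ×-dec (G u v ≟ᵇ true)) (λ u → smallerChild? u ⊎-dec smallerParent? u)
             (λ (u<v , e) → [ (λ p → inj₁ (u<v , p)) , (λ p → inj₂ (u<v , p)) ]′ (true⇒edge e))
             [ (λ (u<v , p) → u<v , edge⇒true (inj₁ p)) , (λ (u<v , p) → u<v , edge⇒true (inj₂ p)) ]′ ⟩
      count (λ u → smallerChild? u ⊎-dec smallerParent? u)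
        ≡⟨ count-⊎ smallerChild? smallerParent? (λ (_ , p) (_ , q) → child-not-parent p q) ⟩
      count smallerChild? + count smallerParent?
        ≡⟨ cong (count smallerChild? +_) count-smallerParent ⟩
      count smallerChild? + count aboveParent?
        ≡⟨ count-⊎ smallerChild? aboveParent? (λ (u<v , _) (u≡v , _) → <⇒≢ u<v u≡v) ⟨
      count (λ u → smallerChild? u ⊎-dec aboveParent? u)
        ≡⟨ count-cong (λ u → smallerChild? u ⊎-dec aboveParent? u) (child? r (heads f) v)
             [ head⇐child , head⇐parent ]′ head⇒ ⟩
      children r (heads f) v ∎
      where
      open ≡-Reasoning
      head⇐child : ∀ {u} → u Fin.< v × u ≢ r × f u ≡ v → u ≢ r × heads f u ≡ v
      head⇐child (u<v , u≢r , refl) = u≢r , larger-≰ (ℕ.<⇒≱ u<v)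
      head⇐parent : ∀ {u} → u ≡ v × v ≢ r × f v Fin.< v → u ≢ r × heads f u ≡ v
      head⇐parent (refl , v≢r , fv<v) = v≢r , larger-≤ (ℕ.<⇒≤ fv<v)
      head⇒ : ∀ {u} → u ≢ r × heads f u ≡ v →
        (u Fin.< v × u ≢ r × f u ≡ v) ⊎ (u ≡ v × v ≢ r × f v Fin.< v)
      head⇒ {u} (u≢r , eq) with f u ≤? u
      ... | no fu≰u = inj₁ (subst (u Fin.<_) eq (ℕ.≰⇒> fu≰u) , u≢r , eq)
      head⇒ {u} (u≢r , refl) | yes fu≤u =
        inj₂ (refl , u≢r , ℕ.≤∧≢⇒< fu≤u (parent≢ u≢r ∘ toℕ-injective))

    degree-children : degree G v ≡ children r f v + count parent?
    degree-children = trans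
      (count-cong (λ u → G u v ≟ᵇ true) (λ u → child? r f v u ⊎-dec parent? u) true⇒edge edge⇒true)
      (count-⊎ (child? r f v) parent? child-not-parent)

    -- Besides the children, a neighbour is the parent, which exists exactly off the root, where 1
    -- is subtracted.
    globalIndeg-children : globalIndeg r G v ≡ children r f v
    globalIndeg-children with v ≟ r
    ... | yes v≡r = begin
      degree G v                          ≡⟨ degree-children ⟩
      children r f v + count parent?      ≡⟨ cong (children r f v +_) (count-none parent? (λ _ (v≢r , _) → v≢r v≡r)) ⟩
      children r f v + 0                  ≡⟨ ℕ.+-identityʳ _ ⟩
      children r f v                      ∎
      where open ≡-Reasoning
    ... | no v≢r = begin
      degree G v ∸ 1                              ≡⟨ cong (_∸ 1) degree-children ⟩
      children r f v + count parent? ∸ 1          ≡⟨ cong (λ c → children r f v + c ∸ 1) only-parent ⟩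
      children r f v + 1 ∸ 1                      ≡⟨ ℕ.m+n∸n≡m _ 1 ⟩
      children r f v                              ∎
      where
      open ≡-Reasoning
      only-parent : count parent? ≡ 1
      only-parent = trans
        (count-cong parent? (_≟ f v) (λ (_ , eq) → sym eq) (λ eq → v≢r , sym eq))
        (count-≟ (f v))

-- Changing the root

module _ {n : ℕ} (r r′ : Fin n) where

  private
    ρ : Permutation′ n
    ρ = transpose r r′

    ρρ : ∀ u → ρ ⟨$⟩ʳ (ρ ⟨$⟩ʳ u) ≡ u
    ρρ = transpose-involutive r r′

  -- The tree with `r` and `r′` exchanged as vertex names; this moves the root and merely renames
  -- the fibres.
  conjugate : Map n → Map n
  conjugate f u = ρ ⟨$⟩ʳ f (ρ ⟨$⟩ʳ u)

  conjugate-⇝ : ∀ {f u w} → f ⊢ u ⇝ w → conjugate f ⊢ ρ ⟨$⟩ʳ u ⇝ (ρ ⟨$⟩ʳ w)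
  conjugate-⇝ stop = stop
  conjugate-⇝ {f} {u} {w} (up p) = up
    (subst (λ x → conjugate f ⊢ ρ ⟨$⟩ʳ f x ⇝ (ρ ⟨$⟩ʳ w)) (sym (ρρ u)) (conjugate-⇝ p))

  conjugate-reaches : ∀ {f x y} → ρ ⟨$⟩ʳ x ≡ y → ReachesRoot x f → ReachesRoot y (conjugate f)
  conjugate-reaches {f} {x} refl (fx≡x , reach) =
      cong (ρ ⟨$⟩ʳ_) (trans (cong f (ρρ x)) fx≡x)
    , λ v → subst (conjugate f ⊢_⇝ (ρ ⟨$⟩ʳ x)) (ρρ v) (conjugate-⇝ (reach (ρ ⟨$⟩ʳ v)))

  rerooting : Inverse (Maps (ReachesRoot r)) (Maps (ReachesRoot r′))
  rerooting = involution conjugate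
    (λ f≗g u → cong (ρ ⟨$⟩ʳ_) (f≗g _))
    (λ f u → trans (ρρ _) (cong f (ρρ u)))
    (conjugate-reaches (transposeˡ r r′)) (conjugate-reaches (transposeʳ r r′))

  rerooting-children : ∀ f i → mult (children r f) i ≡ mult (children r′ (conjugate f)) i
  rerooting-children f i = trans
    (mult-cong (children r f) (children r′ (conjugate f) ∘ (ρ ⟨$⟩ʳ_)) pointwise i)
    (mult-permute (children r′ (conjugate f)) ρ i)
    where
    pointwise : ∀ v → children r f v ≡ children r′ (conjugate f) (ρ ⟨$⟩ʳ v)
    pointwise v = sym (trans
      (children-permuteᵛ r′ (f ∘ (ρ ⟨$⟩ʳ_)) ρ v)
      (children-permuteᵘ r′ f ρ (transposeʳ r r′) v))

-- Assembly of the bijection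

treeRelabelling : ∀ N → Inverse (Maps (ReachesRoot {suc N} zero)) (Maps (ReachesRoot {suc N} zero))
-- With a single vertex the last vertex is the root itself, so the passage through codes starts at
-- two vertices.
treeRelabelling zero    = Identity.inverse (Maps (ReachesRoot zero))
treeRelabelling (suc M) =
  Compose.inverse (Symmetry.inverse (codeTree M)) (Compose.inverse (codes (suc M)) (codeTree M))

-- Merging preserves both statistics: heads are carried from the tree `t` to its code `c`, and plain
-- fibres from the code `d` to the resulting tree. The exchange of statistics happens between the
-- codes.
treeRelabelling-children : ∀ N t i →
  mult (children zero (heads (proj₁ t))) i ≡ mult (children zero (proj₁ (Inverse.to (treeRelabelling N) t))) i
treeRelabelling-children zero (f , _) = mult-cong _ _
  (children-cong zero (heads f) f λ { zero 0≢0 → contradiction refl 0≢0 })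
treeRelabelling-children (suc M) t i = begin
  mult (children zero (heads (proj₁ t))) i   ≡⟨ mult-cong _ _ (children-cong zero _ _ (λ u _ → heads-t u)) i ⟩
  mult (children zero (heads (proj₁ c))) i   ≡⟨ codes-children (suc M) c i ⟩
  mult (children zero (proj₁ d)) i           ≡⟨ mult-cong _ _ (merging-children (suc M) M ℕ.≤-refl (partial d)) i ⟨
  mult (children zero (proj₁ (Inverse.to (codeTree M) d))) i ∎
  where
  open ≡-Reasoning
  c d : Σ (Map (suc (suc M))) (IsCode (suc M))
  c = Inverse.from (codeTree M) t
  d = Inverse.to (codes (suc M)) c
  partial : Σ _ (IsCode (suc M)) → Σ _ (Partial (suc M) 0)
  partial = Inverse.to (codePartial M)
  heads-t : heads (proj₁ t) ≗ heads (proj₁ c)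
  heads-t u = trans
    (cong (larger u) (sym (Inverse.strictlyInverseˡ (codeTree M) t u)))
    (merging-heads (suc M) M ℕ.≤-refl (partial c) u)

-- Local indegrees do not depend on a root, so they are read with root 0. The root moves only after
-- the statistic has become global, since renaming vertices preserves that one.
localToGlobal : ∀ N (r : Fin (suc N)) → Inverse (Trees zero) (Trees r)
localToGlobal N r =
  Compose.inverse (rooting zero)
  (Compose.inverse (treeRelabelling N)
  (Compose.inverse (rerooting zero r)
  (Symmetry.inverse (rooting r))))

localToGlobal-indeg : ∀ N r t i →
  mult (localIndeg (proj₁ t)) i ≡ mult (globalIndeg r (proj₁ (Inverse.to (localToGlobal N r) t))) i
localToGlobal-indeg N r t i = begin
  mult (localIndeg (proj₁ t)) i
    ≡⟨ mult-cong _ _ (localIndeg-children zero (proj₂ p) (parentMap-represents zero (proj₂ t))) i ⟩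
  mult (children zero (heads (proj₁ p))) i
    ≡⟨ treeRelabelling-children N p i ⟩
  mult (children zero (proj₁ q)) i
    ≡⟨ rerooting-children zero r (proj₁ q) i ⟩
  mult (children r (proj₁ q′)) i
    ≡⟨ mult-cong _ _ (globalIndeg-children r (proj₂ q′) (toGraph-represented r (proj₁ q′))) i ⟨
  mult (globalIndeg r (toGraph r (proj₁ q′))) i ∎
  where
  open ≡-Reasoning
  p = Inverse.to (rooting zero) t
  q = Inverse.to (treeRelabelling N) p
  q′ = Inverse.to (rerooting zero r) q

degree-cong : ∀ {n} {G H : Graph n} → (∀ u v → G u v ≡ H u v) → degree G ≗ degree H
degree-cong {G = G} {H} G≈H v = count-cong (λ u → G u v ≟ᵇ true) (λ u → H u v ≟ᵇ true)
  (trans (sym (G≈H _ v))) (trans (G≈H _ v))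

globalIndeg-cong : ∀ {n} (r : Fin n) {G H : Graph n} → (∀ u v → G u v ≡ H u v) →
  globalIndeg r G ≗ globalIndeg r H
globalIndeg-cong r G≈H v with v ≟ r
... | yes _ = degree-cong G≈H v
... | no _  = cong (_∸ 1) (degree-cong G≈H v)

forget : ∀ {n} {P : Graph n → Set} → (Σ (Graph n) λ G → IsTree G × P G) → Σ (Graph n) IsTree
forget (G , tree , _) = G , tree

theorem1p3 : (n : ℕ) → 1 ≤ n → (λs : List ℕ) → IsPartition λs (n ∸ 1) →
    (r : Fin n) → Bijection (LocalTrees n λs) (RootedTrees n r λs)
theorem1p3 (suc N) _ λs _ r = Inverse⇒Bijection record
  { to        = λ (G , tree , λ-G) →
      let H , treeᴴ = Φ.to (G , tree)
      in H , treeᴴ , λ i 1≤i → trans (sym (localToGlobal-indeg N r (G , tree) i)) (λ-G i 1≤i)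
  ; from      = λ (H , tree , λ-H) →
      let G , treeᴳ = Φ.from (H , tree)
      in G , treeᴳ , λ i 1≤i → trans (localToGlobal-indeg N r (G , treeᴳ) i)
           -- The round trip returns `H` only up to pointwise equality, so its indegrees have to be
           -- transported.
           (trans (mult-cong _ _ (globalIndeg-cong r (Φ.strictlyInverseˡ (H , tree))) i) (λ-H i 1≤i))
  ; to-cong   = λ {A} {B} → Φ.to-cong {forget A} {forget B}
  ; from-cong = λ {A} {B} → Φ.from-cong {forget A} {forget B}
  ; inverse   = (λ {A} {B} → Φ.inverseˡ {forget A} {forget B})
              , (λ {A} {B} → Φ.inverseʳ {forget A} {forget B}) }
  where module Φ = Inverse (localToGlobal N r)
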